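{- (M-SING) The following type is inhabited: $$\prod_{a:M}\ \sum_{b:M}\ \prod_{z:M}\ \bigl(z\in b\;\simeq\;z=_M a\bigr).$$
   Context: The setting is Martin-Löf (homotopy/univalent) type theory with the Univalence Axiom (hence function extensionality); $A:\mathrm{Set}$ means "$A$ is a type" (not necessarily a 0-type), and $A\simeq B$ is the type of equivalences as in the Homotopy Type Theory book. $U:\mathrm{Set}$ is a univalent universe with decoding function $T:U\to\mathrm{Set}$; univalent means that for $a,b:U$ the canonical map $\mathrm{Id}_U\,a\,b\to (T\,a\simeq T\,b)$ is an equivalence. $U$ is assumed closed under $+$, $\Sigma$-, $\Pi$- and identity types, and to contain a code for the unit type $1$. $M := W_{a:U}\,T\,a$ is the W-type with canonical elements $\sup\,a\,f$, where $a:U$ and $f:T\,a\to M$. The relation $=_M\,:M\to M\to\mathrm{Set}$ is defined by recursion: $$(\sup\,a\,f)=_M(\sup\,b\,g)\;:=\;\sum_{\alpha:T a\simeq T b}\ \prod_{x:T a}\ (f\,x)=_M\bigl(g\,(\alpha\,x)\bigr).$$ The relation $\in\,:M\to M\to\mathrm{Set}$ is defined by $$x\in(\sup\,b\,g)\;:=\;\sum_{i:T b}\ x=_M(g\,i).$$ -}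

{-# OPTIONS --without-K #-}
module Defs where

open import Data.Container.Core using (_▷_)
open import Data.Product.Base using (Σ; Σ-syntax; _,_)
open import Data.Sum.Base using (_⊎_)
open import Data.Unit.Polymorphic.Base using (⊤)
open import Data.W using (W; sup)
open import Function.Base using (id)
open import Function.Properties.Inverse.HalfAdjointEquivalence using (_≃_)
open import Level using (Level; _⊔_) renaming (suc to lsuc)
open import Relation.Binary.PropositionalEquality.Core using (_≡_; refl; cong)

-- The library provides _≃_ only as a single record; this is the
-- half-adjoint structure of that record over a fixed underlying map.

IsEquiv : ∀ {a b} {A : Set a} {B : Set b} → (A → B) → Set (a ⊔ b)
IsEquiv {A = A} {B} f =
  Σ[ g ∈ (B → A) ]
  Σ[ η ∈ (∀ x → g (f x) ≡ x) ]
  Σ[ ε ∈ (∀ y → f (g y) ≡ y) ]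
  (∀ x → cong f (η x) ≡ ε (f x))

≃-refl : ∀ {a} {A : Set a} → A ≃ A
≃-refl = record
  { to               = id
  ; from             = id
  ; left-inverse-of  = λ _ → refl
  ; right-inverse-of = λ _ → refl
  ; left-right       = λ _ → refl
  }

id⇒≃ : ∀ {u t} {U : Set u} (T : U → Set t) {a b : U} → a ≡ b → T a ≃ T b
id⇒≃ T refl = ≃-refl

IsUnivalent : ∀ {u t} {U : Set u} → (U → Set t) → Set (u ⊔ t)
IsUnivalent {U = U} T = (a b : U) → IsEquiv (id⇒≃ T {a} {b})

-- The Univalence Axiom for the ambient universe Set ℓ.

Univalence : (ℓ : Level) → Set (lsuc ℓ)
Univalence ℓ = IsUnivalent {U = Set ℓ} id

-- Decoding equations that would be judgmental in a Tarski universe are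
-- only required up to equivalence.

record UnivalentUniverse (u t : Level) : Set (lsuc (u ⊔ t)) where
  field
    U          : Set u
    T          : U → Set t
    univalent  : IsUnivalent T

    sumᵁ       : U → U → U
    T-sum      : ∀ a b → T (sumᵁ a b) ≃ (T a ⊎ T b)

    Σᵁ         : (a : U) → (T a → U) → U
    T-Σ        : ∀ a b → T (Σᵁ a b) ≃ Σ (T a) (λ x → T (b x))

    Πᵁ         : (a : U) → (T a → U) → U
    T-Π        : ∀ a b → T (Πᵁ a b) ≃ ((x : T a) → T (b x))

    Idᵁ        : (a : U) → T a → T a → U
    T-Id       : ∀ a x y → T (Idᵁ a x y) ≃ (x ≡ y)

    unitᵁ      : U
    T-unit     : T unitᵁ ≃ ⊤ {t}

module IterativeMultisets {u t} (𝒰 : UnivalentUniverse u t) where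
  open UnivalentUniverse 𝒰

  infix 4 _=ᴹ_ _∈_

  M : Set (u ⊔ t)
  M = W (U ▷ T)

  _=ᴹ_ : M → M → Set t
  sup (a , f) =ᴹ sup (b , g) =
    Σ[ α ∈ T a ≃ T b ] ((x : T a) → f x =ᴹ g (_≃_.to α x))

  _∈_ : M → M → Set t
  x ∈ sup (b , g) = Σ[ i ∈ T b ] (x =ᴹ g i)

{-# OPTIONS --without-K #-}
module Submission where

-- The singleton of a is the multiset sup 1 (λ _ → a) indexed by the unit
-- code: by definition z ∈ b is then the product T 1 × (z =ᴹ a), and the
-- factor T 1 is contractible, so the second projection is an equivalence.

open import Defs
open import Data.Product.Base using (Σ-syntax; _×_; _,_; proj₂)
open import Data.Unit.Polymorphic.Base using (tt)
open import Data.W using (sup)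
open import Function.Properties.Inverse.HalfAdjointEquivalence using (_≃_)
open import Relation.Binary.PropositionalEquality.Core using (_≡_; refl; cong)

-- The hypotheses exhibit A as contractible with centre c.
contractible-× : ∀ {a b} {A : Set a} {B : Set b}
                 (c : A) → (∀ x → c ≡ x) → (A × B) ≃ B
contractible-× {A = A} c contr = record
  { to               = proj₂
  ; from             = c ,_
  ; left-inverse-of  = λ (x , y) → cong (_, y) (contr x)
  ; right-inverse-of = λ _ → refl
  ; left-right       = λ (x , y) → cong-proj₂ y (contr x)
  }
  where
  cong-proj₂ : ∀ y {x x′ : A} (p : x ≡ x′) →
               cong proj₂ (cong (_, y) p) ≡ refl {x = y}
  cong-proj₂ y refl = refl

proposition4 : (∀ ℓ → Univalence ℓ) →
    ∀ {u t} (𝒰 : UnivalentUniverse u t) →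
    let open IterativeMultisets 𝒰 in
    (a : M) → Σ[ b ∈ M ] ((z : M) → (z ∈ b) ≃ (z =ᴹ a))
proposition4 _ 𝒰 a =
    sup (unitᵁ , λ _ → a)
    -- The contraction has the required type by the η-rule of the unit
    -- type: to i and tt are definitionally equal.
  , λ z → contractible-× (_≃_.from T-unit tt) (_≃_.left-inverse-of T-unit)
  where open UnivalentUniverse 𝒰
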